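{- Let $k \geq 2$ and $N\ge 1$ be integers and let $n=8Nk+1$. There is a set of mutually orthogonal cyclic $4k$-cycle systems of order $n$ of size at least \[ \frac{N}{16k-2}-1=\frac{n-1}{8k(16k-2)}-1. \] Thus, if $n\equiv 1\pmod{8k}$, then $\mu(4k,n)\geq \mu'(4k,n)\geq \frac{n-1}{8k(16k-2)}-1$.
   Context: An $\ell$-cycle system of order $n$ is a set of $\ell$-cycles whose edge sets partition the edge set of $K_n$. Two such systems $\mathcal F,\mathcal F'$ are orthogonal if every $C\in\mathcal F$ and $C'\in\mathcal F'$ share at most one edge; mutually orthogonal means pairwise orthogonal. With vertex set $\mathbb{Z}_n$, a system is cyclic if it is closed under translating every cycle by any $g\in\mathbb{Z}_n$. $\mu(\ell,n)$ (resp. $\mu'(\ell,n)$) is the maximum size of a set of mutually orthogonal (resp. mutually orthogonal cyclic) $\ell$-cycle systems of order $n$. -}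

module Defs where

open import Data.Nat using (ℕ; zero; suc; _+_; _*_; _∸_; _≤_; NonZero)
open import Data.Nat.DivMod using (_mod_)
open import Data.Fin using (Fin; toℕ)
open import Data.Product using (Σ; ∃; _×_; _,_)
open import Data.Sum using (_⊎_)
open import Relation.Binary.PropositionalEquality using (_≡_; _≢_)
open import Function.Definitions using (Injective)

-- An ℓ-cycle on the vertex set ℤ_n (= Fin n), given by its cyclic
-- sequence of vertices v₀ v₁ … v_{ℓ-1}.
Cyc : ℕ → ℕ → Set
Cyc ℓ n = Fin ℓ → Fin n

Succ : {ℓ : ℕ} → Fin ℓ → Fin ℓ → Set
Succ {ℓ} i j = (toℕ j ≡ suc (toℕ i)) ⊎ ((toℕ i ≡ ℓ ∸ 1) × (toℕ j ≡ 0))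

IsCycle : {ℓ n : ℕ} → Cyc ℓ n → Set
IsCycle {ℓ} c = (3 ≤ ℓ) × Injective _≡_ _≡_ c

HasEdge : {ℓ n : ℕ} → Cyc ℓ n → Fin n → Fin n → Set
HasEdge c x y =
  ∃ λ i → ∃ λ j → Succ i j × (((c i ≡ x) × (c j ≡ y)) ⊎ ((c i ≡ y) × (c j ≡ x)))

-- Two cycles have the same edge set (hence are the same cycle).
SameEdges : {ℓ n : ℕ} → Cyc ℓ n → Cyc ℓ n → Set
SameEdges c d = ∀ x y → (HasEdge c x y → HasEdge d x y) × (HasEdge d x y → HasEdge c x y)

record CycleFamily (ℓ n : ℕ) : Set where
  field
    size : ℕ
    cyc  : Fin size → Cyc ℓ n
open CycleFamily public

IsCycleSystem : {ℓ n : ℕ} → CycleFamily ℓ n → Set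
IsCycleSystem F =
  (∀ t → IsCycle (cyc F t)) ×
  (∀ x y → x ≢ y →
     ∃ λ t → HasEdge (cyc F t) x y × (∀ t' → HasEdge (cyc F t') x y → t' ≡ t))

shift : {n : ℕ} .{{_ : NonZero n}} → Fin n → Fin n → Fin n
shift {n} g x = (toℕ x + toℕ g) mod n

translate : {ℓ n : ℕ} .{{_ : NonZero n}} → Fin n → Cyc ℓ n → Cyc ℓ n
translate g c i = shift g (c i)

IsCyclic : {ℓ n : ℕ} .{{_ : NonZero n}} → CycleFamily ℓ n → Set
IsCyclic F = ∀ t g → ∃ λ t' → SameEdges (translate g (cyc F t)) (cyc F t')

AtMostOneCommonEdge : {ℓ n : ℕ} → Cyc ℓ n → Cyc ℓ n → Set
AtMostOneCommonEdge c d =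
  ∀ x y u v → HasEdge c x y → HasEdge d x y → HasEdge c u v → HasEdge d u v →
    ((x ≡ u) × (y ≡ v)) ⊎ ((x ≡ v) × (y ≡ u))

Orthogonal : {ℓ n : ℕ} → CycleFamily ℓ n → CycleFamily ℓ n → Set
Orthogonal F G = ∀ s t → AtMostOneCommonEdge (cyc F s) (cyc G t)

MOCyclicSystems : (m ℓ n : ℕ) .{{_ : NonZero n}} → Set
MOCyclicSystems m ℓ n =
  Σ (Fin m → CycleFamily ℓ n) λ 𝓕 →
    (∀ i → IsCycleSystem (𝓕 i) × IsCyclic (𝓕 i)) ×
    (∀ i j → i ≢ j → Orthogonal (𝓕 i) (𝓕 j))

{-# OPTIONS --safe #-}
module Submission where

-- Put K = 2k. The vertices of a base cycle alternate between low and high ones,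
--   lᵢ = φᵢ + cᵢ N   and   hᵢ = φᵢ + φᵢ₊₁ + gᵢ N + 1,   φᵢ = (j + s (i mod K)) mod N,
-- in the cyclic order l₀ h₀ l₁ h₁ … (indices mod K). The edge hᵢ lᵢ has difference
-- φᵢ₊₁ + 1 + (gᵢ − cᵢ) N and hᵢ lᵢ₊₁ has difference φᵢ + 1 + (gᵢ − cᵢ₊₁) N. The levels c, g are
-- chosen so that gᵢ − cᵢ and gᵢ − cᵢ₊₁ together run through 0, …, 4k − 1. Hence, for fixed s, as j
-- runs through ℤ_N each difference 1, …, 4kN occurs exactly once, and the translates of the base
-- cycles form a cyclic system.
-- If two cycles of the systems s ≠ t share two edges, then comparing their differences, and the
-- relative position of their low ends, modulo N gives (s − t)(x − y) ≡ 0, where x, y < K are the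
-- indices of the two differences, respectively of the two low ends. As |s − t| K < N, the two edges
-- have the same difference index and the same low end index, so they coincide.

open import Defs
open import Data.Bool using (Bool; true; false; not; _xor_)
open import Data.Empty using (⊥; ⊥-elim)
open import Data.Fin using (Fin; toℕ; fromℕ<; remQuot; combine)
open import Data.Fin.Properties using
  (toℕ<n; toℕ-injective; toℕ-fromℕ<; remQuot-combine; combine-remQuot)
open import Data.Nat using (ℕ; zero; suc; _+_; _*_; _∸_; _≤_; _<_; z≤n; s≤s; z<s;
  NonZero; >-nonZero; >-nonZero⁻¹)
open import Data.Nat.DivMod using
  (_/_; _%_; _mod_; m≡m%n+[m/n]*n; m%n<n; n%n≡0; m<n⇒m%n≡m; m/n*n≤m; m<n*o⇒m/o<n)
open import Data.Nat.Properties
open import Data.Nat.Tactic.RingSolver using (solve-∀)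
open import Data.Product using (∃; _×_; _,_; proj₁; proj₂; swap)
open import Data.Sum using (_⊎_; inj₁; inj₂)
open import Relation.Binary.Definitions using (tri<; tri≈; tri>)
open import Relation.Binary.PropositionalEquality
open import Relation.Nullary using (¬_; yes; no; contradiction)

-- Congruences

-- Multiples of `M` on both sides avoid subtraction and any case distinction on which of `x`, `y` is
-- larger.
record Cong (M x y : ℕ) : Set where
  constructor cong-by
  field
    u v : ℕ
    eq  : x + u * M ≡ y + v * M

module _ {M : ℕ} where

  ≡⇒Cong : ∀ {x y} → x ≡ y → Cong M x y
  ≡⇒Cong refl = cong-by 0 0 refl

  Cong-sym : ∀ {x y} → Cong M x y → Cong M y x
  Cong-sym (cong-by u v eq) = cong-by v u (sym eq)

  Cong-+-cong : ∀ {x y z w} → Cong M x y → Cong M z w → Cong M (x + z) (y + w)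
  Cong-+-cong {x} {y} {z} {w} (cong-by u v eq) (cong-by u′ v′ eq′) = cong-by (u + u′) (v + v′)
    (trans (regroup x z u u′ M) (trans (cong₂ _+_ eq eq′) (sym (regroup y w v v′ M))))
    where
    regroup : ∀ x z u u′ M → x + z + (u + u′) * M ≡ x + u * M + (z + u′ * M)
    regroup = solve-∀

  Cong-+-cancelʳ : ∀ {x y} z → Cong M (x + z) (y + z) → Cong M x y
  Cong-+-cancelʳ {x} {y} z (cong-by u v eq) = cong-by u v
    (+-cancelʳ-≡ z _ _ (trans (shuffle x u z M) (trans eq (sym (shuffle y v z M)))))
    where
    shuffle : ∀ x u z M → x + u * M + z ≡ x + z + u * M
    shuffle = solve-∀

  Cong-trans : ∀ {x y z} → Cong M x y → Cong M y z → Cong M x z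
  Cong-trans {x} {y} {z} p q = Cong-+-cancelʳ y
    (subst (Cong M (x + y)) (+-comm y z) (Cong-+-cong p q))

  Cong-+-cancel : ∀ {x y z w} → Cong M z w → Cong M (x + z) (y + w) → Cong M x y
  Cong-+-cancel {z = z} p q =
    Cong-+-cancelʳ z (Cong-trans q (Cong-+-cong (≡⇒Cong refl) (Cong-sym p)))

  Cong-drop : ∀ x q → Cong M (x + q * M) x
  Cong-drop x q = cong-by 0 q (+-identityʳ _)

  Cong-% : ∀ x .{{_ : NonZero M}} → Cong M (x % M) x
  Cong-% x = cong-by (x / M) 0 (trans (sym (m≡m%n+[m/n]*n x M)) (sym (+-identityʳ x)))

  private
    -- With `y = x + d` and `u = v + w` the equation becomes `d = w * M`, and a multiple of `M`
    -- below `M` is 0.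
    Cong-bounded⇒≡-≤ : ∀ {x y} → x ≤ y → y < x + M → Cong M x y → x ≡ y
    Cong-bounded⇒≡-≤ {x} {y} x≤y y<x+M (cong-by u v eq) with m≤n⇒∃[o]m+o≡n x≤y
    ... | d , refl = sym (trans (cong (x +_) d≡0) (+-identityʳ x))
      where
      d<M : d < M
      d<M = +-cancelˡ-< x d M y<x+M

      uM≡d+vM : u * M ≡ d + v * M
      uM≡d+vM = +-cancelˡ-≡ x _ _ (trans eq (+-assoc x d (v * M)))

      v≤u : v ≤ u
      v≤u = *-cancelʳ-≤ v u M {{>-nonZero (≤-<-trans z≤n d<M)}}
              (≤-trans (m≤n+m (v * M) d) (≤-reflexive (sym uM≡d+vM)))

      multiple : ∀ w → w * M < M → w * M ≡ 0
      multiple zero    _ = refl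
      multiple (suc w) p = contradiction p (≤⇒≯ (m≤m+n M (w * M)))

      d≡0 : d ≡ 0
      d≡0 with m≤n⇒∃[o]m+o≡n v≤u
      ... | w , refl = trans (sym wM≡d) (multiple w (subst (_< M) (sym wM≡d) d<M))
        where
        wM≡d : w * M ≡ d
        wM≡d = +-cancelʳ-≡ (v * M) _ _
          (trans (trans (+-comm (w * M) (v * M)) (sym (*-distribʳ-+ M v w))) uM≡d+vM)

  Cong-bounded⇒≡ : ∀ {x y} → x < y + M → y < x + M → Cong M x y → x ≡ y
  Cong-bounded⇒≡ {x} {y} x<y+M y<x+M p with ≤-total x y
  ... | inj₁ x≤y = Cong-bounded⇒≡-≤ x≤y y<x+M p
  ... | inj₂ y≤x = sym (Cong-bounded⇒≡-≤ y≤x x<y+M (Cong-sym p))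

  Cong-<⇒≡ : ∀ {x y} → x < M → y < M → Cong M x y → x ≡ y
  Cong-<⇒≡ {x} {y} x<M y<M =
    Cong-bounded⇒≡ (≤-trans x<M (m≤n+m M y)) (≤-trans y<M (m≤n+m M x))

digits-unique : ∀ {M x y q r} → x < M → y < M → x + q * M ≡ y + r * M → x ≡ y × q ≡ r
digits-unique {M} {x} {y} {q} {r} x<M y<M eq = x≡y , *-cancelʳ-≡ q r M
    (+-cancelˡ-≡ y _ _ (trans (cong (_+ q * M) (sym x≡y)) eq))
  where
  instance _ = >-nonZero (≤-<-trans z≤n x<M)
  x≡y = Cong-<⇒≡ x<M y<M (cong-by q r eq)

private
  -- With `s = t + d` and `x = y + e` the two sides differ by `d * e`, which is at most `m * B < N`.
  -- So `d * e = 0`, and `d ≠ 0` because `s ≢ t`.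
  exchange⇒≡-≤ : ∀ {N m B s t x y} → m * B < N → t ≤ s → y ≤ x → s ≤ m → x ≤ B → s ≢ t →
    Cong N (s * x + t * y) (s * y + t * x) → x ≡ y
  exchange⇒≡-≤ {N} {t = t} {y = y} mB<N t≤s y≤x s≤m x≤B s≢t p
    with m≤n⇒∃[o]m+o≡n t≤s | m≤n⇒∃[o]m+o≡n y≤x
  ... | d , refl | e , refl = conclude (m*n≡0⇒m≡0∨n≡0 d de≡0)
    where
    expand : ∀ t d y e →
      (t + d) * (y + e) + t * y ≡ d * e + ((t + d) * y + t * (y + e))
    expand = solve-∀

    de<N : d * e < N
    de<N = ≤-<-trans (*-mono-≤ (≤-trans (m≤n+m d t) s≤m) (≤-trans (m≤n+m e y) x≤B)) mB<N

    de≡0 : d * e ≡ 0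
    de≡0 = Cong-<⇒≡ de<N (≤-<-trans z≤n de<N)
      (Cong-+-cancelʳ ((t + d) * y + t * (y + e)) 
        (subst (λ z → Cong N z ((t + d) * y + t * (y + e))) (expand t d y e) p))

    conclude : d ≡ 0 ⊎ e ≡ 0 → y + e ≡ y
    conclude (inj₁ refl) = contradiction (+-identityʳ t) s≢t
    conclude (inj₂ refl) = +-identityʳ y

-- The hypothesis is s x + t y ≡ s y + t x, i.e. (s − t)(x − y) ≡ 0.
exchange⇒≡ : ∀ {N m B s t x y} → m * B < N → s ≤ m → t ≤ m → x ≤ B → y ≤ B → s ≢ t →
  Cong N (s * x + t * y) (s * y + t * x) → x ≡ y
exchange⇒≡ {N} {s = s} {t} {x} {y} mB<N s≤m t≤m x≤B y≤B s≢t p with ≤-total t s | ≤-total y x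
... | inj₁ t≤s | inj₁ y≤x = exchange⇒≡-≤ mB<N t≤s y≤x s≤m x≤B s≢t p
... | inj₁ t≤s | inj₂ x≤y = sym (exchange⇒≡-≤ mB<N t≤s x≤y s≤m y≤B s≢t (Cong-sym p))
... | inj₂ s≤t | inj₁ y≤x = exchange⇒≡-≤ mB<N s≤t y≤x t≤m x≤B (≢-sym s≢t)
      (subst₂ (Cong N) (+-comm (s * y) (t * x)) (+-comm (s * x) (t * y)) (Cong-sym p))
... | inj₂ s≤t | inj₂ x≤y = sym (exchange⇒≡-≤ mB<N s≤t x≤y t≤m y≤B (≢-sym s≢t)
      (subst₂ (Cong N) (+-comm (s * x) (t * y)) (+-comm (s * y) (t * x)) p))

-- Cycles as closed walks

toℕ-mod : ∀ x n .{{_ : NonZero n}} → toℕ (x mod n) ≡ x % n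
toℕ-mod x n = toℕ-fromℕ< (m%n<n x n)

Cong-mod : ∀ {n} x .{{_ : NonZero n}} → Cong n (toℕ (x mod n)) x
Cong-mod {n} x = Cong-trans (≡⇒Cong (toℕ-mod x n)) (Cong-% x)

Cong⇒≡ : ∀ {n} {x y : Fin n} → Cong n (toℕ x) (toℕ y) → x ≡ y
Cong⇒≡ {x = x} {y} p = toℕ-injective (Cong-<⇒≡ (toℕ<n x) (toℕ<n y) p)

Cong-shift : ∀ {n} .{{_ : NonZero n}} (g x : Fin n) → Cong n (toℕ (shift g x)) (toℕ x + toℕ g)
Cong-shift g x = Cong-mod (toℕ x + toℕ g)

shift-shift : ∀ {n} .{{_ : NonZero n}} (g h x : Fin n) → shift g (shift h x) ≡ shift (shift g h) x
shift-shift {n} g h x = Cong⇒≡ (Cong-trans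
  (Cong-trans (Cong-shift g (shift h x)) (Cong-+-cong (Cong-shift h x) (≡⇒Cong refl)))
  (Cong-sym (Cong-trans (Cong-shift (shift g h) x)
    (subst (Cong n _) (sym (+-assoc (toℕ x) (toℕ h) (toℕ g)))
      (Cong-+-cong (≡⇒Cong {x = toℕ x} refl) (Cong-shift g h))))))

HasEdge-cong : ∀ {ℓ n} {c d : Cyc ℓ n} → (∀ i → c i ≡ d i) → ∀ {x y} → HasEdge c x y → HasEdge d x y
HasEdge-cong c≗d (i , j , i→j , inj₁ (p , q)) =
  i , j , i→j , inj₁ (trans (sym (c≗d i)) p , trans (sym (c≗d j)) q)
HasEdge-cong c≗d (i , j , i→j , inj₂ (p , q)) =
  i , j , i→j , inj₂ (trans (sym (c≗d i)) p , trans (sym (c≗d j)) q)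

≗⇒SameEdges : ∀ {ℓ n} {c d : Cyc ℓ n} → (∀ i → c i ≡ d i) → SameEdges c d
≗⇒SameEdges c≗d x y = HasEdge-cong c≗d , HasEdge-cong (λ i → sym (c≗d i))

HasEdge-sym : ∀ {ℓ n} {c : Cyc ℓ n} {x y} → HasEdge c x y → HasEdge c y x
HasEdge-sym (i , j , i→j , inj₁ p) = i , j , i→j , inj₂ p
HasEdge-sym (i , j , i→j , inj₂ p) = i , j , i→j , inj₁ p

-- Positions range over ℕ, so the wrap-around case of `Succ` turns into the single equation
-- `w ℓ ≡ w 0`.
Traverses : {A : Set} → (ℕ → A) → ℕ → A → A → Set
Traverses w e x y = w e ≡ x × w (suc e) ≡ y ⊎ w e ≡ y × w (suc e) ≡ x

module _ {ℓ n : ℕ} (w : ℕ → Fin n) (closed : w ℓ ≡ w 0) where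

  HasEdge⇒Traverses : ∀ {x y} → HasEdge {ℓ} (λ i → w (toℕ i)) x y → ∃ λ e → e < ℓ × Traverses w e x y
  HasEdge⇒Traverses {x} {y} (i , j , i→j , ends) =
      toℕ i , toℕ<n i , subst (λ z → w (toℕ i) ≡ x × z ≡ y ⊎ w (toℕ i) ≡ y × z ≡ x) (next i→j) ends
    where
    next : Succ i j → w (toℕ j) ≡ w (suc (toℕ i))
    next (inj₁ j≡1+i)       = cong w j≡1+i
    next (inj₂ (i≡ℓ-1 , j≡0)) = trans (cong w j≡0) (trans (sym closed)
      (cong w (trans (sym (m+[n∸m]≡n (≤-trans (s≤s z≤n) (toℕ<n i)))) (cong suc (sym i≡ℓ-1)))))

  Traverses⇒HasEdge : ∀ {e x y} → e < ℓ → Traverses w e x y → HasEdge {ℓ} (λ i → w (toℕ i)) x y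
  Traverses⇒HasEdge {e} {x} {y} e<ℓ ends with m≤n⇒m<n∨m≡n e<ℓ
  ... | inj₁ 1+e<ℓ = fromℕ< e<ℓ , fromℕ< 1+e<ℓ ,
        inj₁ (trans (toℕ-fromℕ< 1+e<ℓ) (cong suc (sym (toℕ-fromℕ< e<ℓ)))) ,
        subst₂ (λ a b → w a ≡ x × w b ≡ y ⊎ w a ≡ y × w b ≡ x)
          (sym (toℕ-fromℕ< e<ℓ)) (sym (toℕ-fromℕ< 1+e<ℓ)) ends
  ... | inj₂ refl = fromℕ< e<ℓ , Fin.zero ,
        inj₂ (toℕ-fromℕ< e<ℓ , refl) ,
        subst₂ (λ a b → a ≡ x × b ≡ y ⊎ a ≡ y × b ≡ x)
          (cong w (sym (toℕ-fromℕ< e<ℓ))) closed ends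

-- Interleaved sequences and parity

interleave : {A : Set} → (ℕ → A) → (ℕ → A) → ℕ → A
interleave f h 0             = f 0
interleave f h 1             = h 0
interleave f h (suc (suc e)) = interleave (λ i → f (suc i)) (λ i → h (suc i)) e

interleave-even : {A : Set} (f h : ℕ → A) → ∀ i → interleave f h (i * 2) ≡ f i
interleave-even f h zero    = refl
interleave-even f h (suc i) = interleave-even _ _ i

interleave-odd : {A : Set} (f h : ℕ → A) → ∀ i → interleave f h (suc (i * 2)) ≡ h i
interleave-odd f h zero    = refl
interleave-odd f h (suc i) = interleave-odd _ _ i

bit : Bool → ℕ
bit false = 0
bit true  = 1

bit<2 : ∀ b → bit b < 2
bit<2 false = s≤s z≤n
bit<2 true  = s≤s (s≤s z≤n)

bit-injective : ∀ {a b} → bit a ≡ bit b → a ≡ b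
bit-injective {false} {false} _ = refl
bit-injective {true}  {true}  _ = refl

data Halves : ℕ → Set where
  half : ∀ i b → Halves (bit b + i * 2)

halves : ∀ e → Halves e
halves 0 = half 0 false
halves 1 = half 0 true
halves (suc (suc e)) with halves e
... | half i false = half (suc i) false
... | half i true  = half (suc i) true

half< : ∀ {i K} b → bit b + i * 2 < K * 2 → i < K
half< {i} {K} b p = *-cancelʳ-< 2 i K (≤-<-trans (m≤n+m (i * 2) (bit b)) p)

<⇒half : ∀ {i K} b → i < K → bit b + i * 2 < K * 2
<⇒half {i} b i<K = ≤-trans (+-monoˡ-≤ (i * 2) (bit<2 b)) (*-monoˡ-≤ 2 i<K)

-- Block pattern: c = 1, 2, 1, 0, 1, 0, … and g = 2, 4, 5, 7, 9, …

alternating : ℕ → Bool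
alternating zero    = false
alternating (suc i) = not (alternating i)

flipped : ℕ → Bool
flipped 0             = true
flipped 1             = false
flipped (suc (suc i)) = alternating i

-- Plain alternation 1, 0, 1, 0, ... with `gᵢ = 2i + 1` would give the same blocks, but `h₀` would
-- share level 1 with every `lᵢ` for even `i`, and nothing would keep it apart from the non-adjacent
-- ones. The altered start confines the overlap to the neighbours `l₁` and `h₀`.
lowLevel : ℕ → ℕ
lowLevel 0             = 1
lowLevel 1             = 2
lowLevel (suc (suc i)) = bit (not (alternating i))

highOffset : ℕ → ℕ
highOffset 0             = 2
highOffset 1             = 2
highOffset (suc (suc i)) = 1

highLevel : ℕ → ℕ
highLevel i = highOffset i + i * 2

-- This is `gᵢ − cᵢ` for `b = false` and `gᵢ − cᵢ₊₁` for `b = true`: `b` selects one of the two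
-- edges at `hᵢ`. The two values are `2i` and `2i + 1`, and `flipped i` tells whether the edge to
-- `lᵢ` has the odd one.
block : ℕ → Bool → ℕ
block i b = bit (flipped i xor b) + i * 2

lowLevel+block : ∀ i b → lowLevel (bit b + i) + block i b ≡ highLevel i
lowLevel+block 0 false = refl
lowLevel+block 0 true  = refl
lowLevel+block 1 false = refl
lowLevel+block 1 true  = refl
lowLevel+block (suc (suc i)) false with alternating i
... | false = refl
... | true  = refl
lowLevel+block (suc (suc i)) true with alternating i
... | false = refl
... | true  = refl

lowLevel≤2 : ∀ i → lowLevel i ≤ 2
lowLevel≤2 0             = s≤s z≤n
lowLevel≤2 1             = ≤-refl
lowLevel≤2 (suc (suc i)) = <⇒≤ (bit<2 _)

highLevel≤ : ∀ i → highLevel i ≤ suc i * 2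
highLevel≤ 0             = ≤-refl
highLevel≤ 1             = ≤-refl
highLevel≤ (suc (suc i)) = n≤1+n _

highLevel-mono : ∀ i → highLevel i < highLevel (suc i)
highLevel-mono 0             = n≤1+n _
highLevel-mono 1             = ≤-refl
highLevel-mono (suc (suc i)) = n≤1+n _

-- Level 2 occurs among both the low and the high vertices, but only at adjacent ones.
lowLevel<highLevel : ∀ i i′ → lowLevel i < highLevel i′ ⊎ i ≡ 1 × i′ ≡ 0
lowLevel<highLevel 0             0               = inj₁ ≤-refl
lowLevel<highLevel 1             0               = inj₂ (refl , refl)
lowLevel<highLevel (suc (suc i)) 0               = inj₁ (bit<2 _)
lowLevel<highLevel i             1               = inj₁ (≤-<-trans (lowLevel≤2 i) (s≤s (s≤s (s≤s z≤n))))
lowLevel<highLevel i             (suc (suc i′))  = inj₁ (≤-<-trans (lowLevel≤2 i) (s≤s (s≤s (s≤s z≤n))))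

-- From index 2 on the level depends on parity only, so at the even index `K` it is back at `c₀ = 1`
-- and the base cycle closes.
lowLevel-even : ∀ k .{{_ : NonZero k}} → lowLevel (k * 2) ≡ 1
lowLevel-even (suc k) = cong (λ b → bit (not b)) (even k)
  where
  even : ∀ i → alternating (i * 2) ≡ false
  even zero    = refl
  even (suc i) = cong (λ b → not (not b)) (even i)

xor-injective : ∀ a {b b′} → a xor b ≡ a xor b′ → b ≡ b′
xor-injective false            eq   = eq
xor-injective true {false} {false} _ = refl
xor-injective true {true}  {true}  _ = refl

block-injective : ∀ {i i′ b b′} → block i b ≡ block i′ b′ → i ≡ i′ × b ≡ b′
block-injective {i} {i′} {b} {b′} eq
  with digits-unique {q = i} {i′} (bit<2 (flipped i xor b)) (bit<2 (flipped i′ xor b′)) eq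
... | eq₁ , refl = refl , xor-injective (flipped i) (bit-injective eq₁)

block-surjective : ∀ r {K} → r < K * 2 → ∃ λ i → i < K × ∃ λ b → block i b ≡ r
block-surjective r r<K with halves r
... | half i a = i , half< a r<K , flipped i xor a ,
  cong (λ b → bit b + i * 2) (xor-involutive (flipped i) a)
  where
  xor-involutive : ∀ x y → x xor (x xor y) ≡ y
  xor-involutive false y     = refl
  xor-involutive true  false = refl
  xor-involutive true  true  = refl

-- Base cycles: `s` numbers the system, `j` the base cycle, `g` the translate

module Construction (k N m : ℕ) .{{_ : NonZero N}} (2≤k : 2 ≤ k) (mK<N : m * (k * 2) < N) where

  private
    K = k * 2
    n = suc (8 * N * k)

    instance
      k-nonZero : NonZero k
      k-nonZero = >-nonZero (≤-trans (s≤s z≤n) 2≤k)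

      K-nonZero : NonZero K
      K-nonZero = m*n≢0 k 2

  -- The nonzero residues modulo `n` form `K * 2 * N` pairs of opposite sign; the same number bounds
  -- the gaps.
  half-order : K * 2 * N + K * 2 * N ≡ 8 * N * k
  half-order = regroup k N
    where
    regroup : ∀ k N → k * 2 * 2 * N + k * 2 * 2 * N ≡ 8 * N * k
    regroup = solve-∀

  residue : ℕ → ℕ → ℕ → ℕ
  residue s j i = (j + s * (i % K)) % N

  low : ℕ → ℕ → ℕ → ℕ
  low s j i = residue s j i + lowLevel i * N

  high : ℕ → ℕ → ℕ → ℕ
  high s j i = suc (residue s j i + residue s j (suc i) + highLevel i * N)

  -- `hᵢ` contains both `φᵢ` and `φᵢ₊₁`. Subtracting a low end removes its own residue, so the
  -- difference carries the residue of the other low neighbour; hence `not b`.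
  gap : ℕ → ℕ → ℕ → Bool → ℕ
  gap s j i b = suc (residue s j (bit (not b) + i) + block i b * N)

  vertex : ℕ → ℕ → ℕ → ℕ
  vertex s j = interleave (low s j) (high s j)

  vertex-even : ∀ s j i → vertex s j (i * 2) ≡ low s j i
  vertex-even s j = interleave-even (low s j) (high s j)

  vertex-odd : ∀ s j i → vertex s j (suc (i * 2)) ≡ high s j i
  vertex-odd s j = interleave-odd (low s j) (high s j)

  walk : ℕ → ℕ → Fin n → ℕ → Fin n
  walk s j g e = shift g (vertex s j e mod n)

  base : ℕ → ℕ → Fin n → Cyc (4 * k) n
  base s j g i = walk s j g (toℕ i)

  residue<N : ∀ s j i → residue s j i < N
  residue<N s j i = m%n<n (j + s * (i % K)) N

  Cong-residue : ∀ s j i → Cong N (residue s j i) (j + s * (i % K))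
  Cong-residue s j i = Cong-% (j + s * (i % K))

  Cong-low : ∀ s j i → Cong N (low s j i) (j + s * (i % K))
  Cong-low s j i = Cong-trans (Cong-drop (residue s j i) (lowLevel i)) (Cong-residue s j i)

  i%K≤K : ∀ i → i % K ≤ K
  i%K≤K i = <⇒≤ (m%n<n i K)

  low-gap : ∀ s j i b → low s j (bit b + i) + gap s j i b ≡ high s j i
  low-gap s j i b = trans (by-end b) (cong (λ l → suc (residue s j i + residue s j (suc i) + l * N))
                                           (lowLevel+block i b))
    where
    rising : ∀ f f′ c B N → f + c * N + suc (f′ + B * N) ≡ suc (f + f′ + (c + B) * N)
    rising = solve-∀
    falling : ∀ f f′ c B N → f′ + c * N + suc (f + B * N) ≡ suc (f + f′ + (c + B) * N)
    falling = solve-∀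
    by-end : ∀ b → low s j (bit b + i) + gap s j i b ≡
      suc (residue s j i + residue s j (suc i) + (lowLevel (bit b + i) + block i b) * N)
    by-end false = rising (residue s j i) (residue s j (suc i)) (lowLevel i) (block i false) N
    by-end true  = falling (residue s j i) (residue s j (suc i)) (lowLevel (suc i)) (block i true) N

  low-closed : ∀ s j → low s j K ≡ low s j 0
  low-closed s j = cong₂ (λ r c → (j + s * r) % N + c * N)
    (trans (n%n≡0 K) (sym (m<n⇒m%n≡m {n = K} (>-nonZero⁻¹ K)))) (lowLevel-even k)

  order≡ : 4 * k ≡ K * 2
  order≡ = regroup k
    where
    regroup : ∀ k → 4 * k ≡ k * 2 * 2
    regroup = solve-∀

  vertex-closed : ∀ s j → vertex s j (4 * k) ≡ vertex s j 0
  vertex-closed s j = trans (cong (vertex s j) order≡)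
    (trans (vertex-even s j K) (low-closed s j))

  walk-closed : ∀ s j g → walk s j g (4 * k) ≡ walk s j g 0
  walk-closed s j g = cong (λ v → shift g (v mod n)) (vertex-closed s j)

  -- Bounds

  digits< : ∀ {r q Q} → r < N → q < Q → r + q * N < Q * N
  digits< {r} {q} r<N q<Q = ≤-trans (+-monoˡ-< (q * N) r<N) (*-monoˡ-≤ N q<Q)

  low<3N : ∀ s j i → low s j i < 3 * N
  low<3N s j i = digits< (residue<N s j i) (s≤s (lowLevel≤2 i))

  gap≤ : ∀ s j {i} b → i < K → gap s j i b ≤ K * 2 * N
  gap≤ s j {i} b i<K = digits< (residue<N s j (bit (not b) + i)) (<⇒half (flipped i xor b) i<K)

  gap+gap<n : ∀ {s j i b s′ j′ i′ b′} → i < K → i′ < K → gap s j i b + gap s′ j′ i′ b′ < n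
  gap+gap<n {s} {j} {b = b} {s′} {j′} {b′ = b′} i<K i′<K =
    s≤s (≤-trans (+-mono-≤ (gap≤ s j b i<K) (gap≤ s′ j′ b′ i′<K)) (≤-reflexive half-order))

  gap<n : ∀ {s j i b} → i < K → gap s j i b < n
  gap<n {s} {j} {i} {b} i<K =
    ≤-<-trans (m≤m+n _ (gap s j i b)) (gap+gap<n {s} {j} {i} {b} {s} {j} {i} {b} i<K i<K)

  -- A congruence modulo `n` need not survive modulo `N`, whereas an equality does. Low levels of at
  -- most 2 keep these sums below `n`, which turns congruences between them into equalities.
  low+low<n : ∀ s j i s′ j′ i′ → low s j i + low s′ j′ i′ < n
  low+low<n s j i s′ j′ i′ = s≤s (begin
    low s j i + low s′ j′ i′  ≤⟨ +-mono-≤ (<⇒≤ (low<3N s j i)) (<⇒≤ (low<3N s′ j′ i′)) ⟩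
    3 * N + 3 * N             ≡⟨ *-distribʳ-+ N 3 3 ⟨
    6 * N                     ≤⟨ *-monoˡ-≤ N {6} {8} (m≤m+n 6 2) ⟩
    8 * N                     ≤⟨ m≤m*n (8 * N) k ⟩
    8 * N * k                 ∎)
    where open ≤-Reasoning

  high<n : ∀ s j {i} → i < K → high s j i < n
  high<n s j {i} i<K = s≤s (begin
    suc (residue s j i + residue s j (suc i) + highLevel i * N)
      ≡⟨ cong suc (+-assoc (residue s j i) _ _) ⟩
    suc (residue s j i) + (residue s j (suc i) + highLevel i * N)
      ≤⟨ +-mono-≤ (residue<N s j i) (<⇒≤ (digits< {q = highLevel i} (residue<N s j (suc i)) ≤-refl)) ⟩
    N + suc (highLevel i) * N
      ≡⟨⟩
    (2 + highLevel i) * N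
      ≤⟨ *-monoˡ-≤ N (+-mono-≤ 2≤K*2 (≤-trans (highLevel≤ i) (*-monoˡ-≤ 2 i<K))) ⟩
    (K * 2 + K * 2) * N
      ≡⟨ *-distribʳ-+ N (K * 2) (K * 2) ⟩
    K * 2 * N + K * 2 * N
      ≡⟨ half-order ⟩
    8 * N * k ∎)
    where
    open ≤-Reasoning
    2≤K*2 : 2 ≤ K * 2
    2≤K*2 = *-monoˡ-≤ 2 (>-nonZero⁻¹ K)

  low<high : ∀ s j i i′ → low s j i < high s j i′
  low<high s j i i′ with lowLevel<highLevel i i′
  ... | inj₁ c<g = m≤n⇒m≤1+n (≤-trans (digits< (residue<N s j i) c<g)
                     (m≤n+m _ (residue s j i′ + residue s j (suc i′))))
  -- The exceptional pair is an edge, so `h₀` exceeds `l₁` by a gap, and gaps are positive.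
  ... | inj₂ (refl , refl) = ≤-trans (≤-trans (≤-reflexive (+-comm 1 (low s j 1)))
                               (+-monoʳ-≤ (low s j 1) (s≤s z≤n))) (≤-reflexive (low-gap s j 0 true))

  -- Consecutive high vertices share the summand `φᵢ₊₁`. Once it is set aside, `φᵢ < N` is
  -- outweighed by the rise in level.
  high-step : ∀ s j i → high s j i < high s j (suc i)
  high-step s j i = s≤s (begin-strict
    residue s j i + r + highLevel i * N      ≡⟨ shuffle (residue s j i) r (highLevel i * N) ⟩
    r + (residue s j i + highLevel i * N)    <⟨ +-monoʳ-< r (digits< (residue<N s j i) (highLevel-mono i)) ⟩
    r + highLevel (suc i) * N                ≤⟨ +-monoˡ-≤ _ (m≤m+n r _) ⟩
    r + residue s j (suc (suc i)) + highLevel (suc i) * N ∎)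
    where
    open ≤-Reasoning
    r = residue s j (suc i)
    shuffle : ∀ a b c → a + b + c ≡ b + (a + c)
    shuffle = solve-∀

  high-mono : ∀ s j {i i′} → i < i′ → high s j i < high s j i′
  high-mono s j {i} {suc i′} (s≤s i≤i′) with m≤n⇒m<n∨m≡n i≤i′
  ... | inj₁ i<i′ = <-trans (high-mono s j i<i′) (high-step s j i′)
  ... | inj₂ refl = high-step s j i

  high-injective : ∀ s j {i i′} → high s j i ≡ high s j i′ → i ≡ i′
  high-injective s j {i} {i′} eq with <-cmp i i′
  ... | tri< i<i′ _ _ = contradiction eq (<⇒≢ (high-mono s j i<i′))
  ... | tri≈ _ i≡i′ _ = i≡i′
  ... | tri> _ _ i′<i = contradiction (sym eq) (<⇒≢ (high-mono s j i′<i))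

  -- Edges of the base cycles and their translates

  -- An edge oriented from its low end `x` to its high end `y`. The field `span` does not mention
  -- `g`, so edges of different translates can be compared by their differences.
  record Joins (s j : ℕ) (g x y : Fin n) : Set where
    constructor joined
    field
      i    : ℕ
      b    : Bool
      i<K  : i < K
      at   : Cong n (toℕ x) (low s j (bit b + i) + toℕ g)
      span : Cong n (toℕ y) (toℕ x + gap s j i b)

  Cong-walk : ∀ s j g e → Cong n (toℕ (walk s j g e)) (vertex s j e + toℕ g)
  Cong-walk s j g e = Cong-trans (Cong-shift g (vertex s j e mod n))
    (Cong-+-cong (Cong-mod (vertex s j e)) (≡⇒Cong refl))

  Cong-walk-low : ∀ s j g i → Cong n (toℕ (walk s j g (i * 2))) (low s j i + toℕ g)
  Cong-walk-low s j g i = subst (λ v → Cong n (toℕ (walk s j g (i * 2))) (v + toℕ g))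
    (vertex-even s j i) (Cong-walk s j g (i * 2))

  Cong-walk-high : ∀ s j g i → Cong n (toℕ (walk s j g (suc (i * 2)))) (high s j i + toℕ g)
  Cong-walk-high s j g i = subst (λ v → Cong n (toℕ (walk s j g (suc (i * 2)))) (v + toℕ g))
    (vertex-odd s j i) (Cong-walk s j g (suc (i * 2)))

  Cong-high : ∀ s j (g : Fin n) i b {x} → Cong n x (low s j (bit b + i) + toℕ g) →
    Cong n (high s j i + toℕ g) (x + gap s j i b)
  Cong-high s j g i b {x} p = Cong-trans (≡⇒Cong (trans (cong (_+ toℕ g) (sym (low-gap s j i b)))
      (shuffle (low s j (bit b + i)) (gap s j i b) (toℕ g))))
    (Cong-+-cong (Cong-sym p) (≡⇒Cong refl))
    where
    shuffle : ∀ a b c → a + b + c ≡ a + c + b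
    shuffle = solve-∀

  joins-low-high : ∀ {s j g x y i} b → i < K → Cong n (toℕ x) (low s j (bit b + i) + toℕ g) →
    Cong n (toℕ y) (high s j i + toℕ g) → Joins s j g x y
  joins-low-high {s} {j} {g} {i = i} b i<K p q =
    joined i b i<K p (Cong-trans q (Cong-high s j g i b p))

  HasEdge⇒Joins : ∀ {s j g x y} → HasEdge (base s j g) x y → Joins s j g x y ⊎ Joins s j g y x
  HasEdge⇒Joins {s} {j} {g} {x} {y} edge
    with e , e<ℓ , ends ← HasEdge⇒Traverses (walk s j g) (walk-closed s j g) edge
    = by-parity (halves e) (≤-trans e<ℓ (≤-reflexive order≡)) ends
    where
    rising : ∀ i → i < K → Joins s j g (walk s j g (i * 2)) (walk s j g (suc (i * 2)))
    rising i i<K = joins-low-high false i<K (Cong-walk-low s j g i) (Cong-walk-high s j g i)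

    falling : ∀ i → i < K → Joins s j g (walk s j g (suc i * 2)) (walk s j g (suc (i * 2)))
    falling i i<K =
      joins-low-high true i<K (Cong-walk-low s j g (suc i)) (Cong-walk-high s j g i)

    by-parity : ∀ {e} → Halves e → e < K * 2 → Traverses (walk s j g) e x y →
      Joins s j g x y ⊎ Joins s j g y x
    by-parity (half i false) e<2K (inj₁ (refl , refl)) = inj₁ (rising i (half< {i} false e<2K))
    by-parity (half i false) e<2K (inj₂ (refl , refl)) = inj₂ (rising i (half< {i} false e<2K))
    by-parity (half i true)  e<2K (inj₁ (refl , refl)) = inj₂ (falling i (half< {i} true e<2K))
    by-parity (half i true)  e<2K (inj₂ (refl , refl)) = inj₁ (falling i (half< {i} true e<2K))

  Joins⇒HasEdge : ∀ {s j g x y} → Joins s j g x y → HasEdge (base s j g) x y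
  Joins⇒HasEdge {s} {j} {g} {x} {y} (joined i b i<K at span) =
    Traverses⇒HasEdge (walk s j g) (walk-closed s j g)
      (≤-trans (<⇒half b i<K) (≤-reflexive (sym order≡)))
      (traverses b at (Cong-trans span (Cong-sym (Cong-high s j g i b at))))
    where
    traverses : ∀ b → Cong n (toℕ x) (low s j (bit b + i) + toℕ g) →
      Cong n (toℕ y) (high s j i + toℕ g) → Traverses (walk s j g) (bit b + i * 2) x y
    traverses false p q = inj₁ (Cong⇒≡ (Cong-trans (Cong-walk-low s j g i) (Cong-sym p)) ,
                                Cong⇒≡ (Cong-trans (Cong-walk-high s j g i) (Cong-sym q)))
    traverses true  p q = inj₂ (Cong⇒≡ (Cong-trans (Cong-walk-high s j g i) (Cong-sym q)) ,
                                Cong⇒≡ (Cong-trans (Cong-walk-low s j g (suc i)) (Cong-sym p)))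

  record Match (s j t j′ : ℕ) (g g′ x y : Fin n) : Set where
    constructor matched
    field
      i       : ℕ
      b       : Bool
      i<K     : i < K
      residue≡ : residue s j (bit (not b) + i) ≡ residue t j′ (bit (not b) + i)
      at      : Cong n (toℕ x) (low s j (bit b + i) + toℕ g)
      at′     : Cong n (toℕ x) (low t j′ (bit b + i) + toℕ g′)
      span    : Cong n (toℕ y) (toℕ x + gap s j i b)

  -- The two gaps are congruent and below `n`, hence equal. Their base-`N` digits separate the
  -- residue from the block, and the block determines `i` and `b`.
  match : ∀ {s j t j′ g g′ x y} → Joins s j g x y → Joins t j′ g′ x y → Match s j t j′ g g′ x y
  match {s} {j} {t} {j′} {x = x} (joined i b i<K at span) (joined i′ b′ i′<K at′ span′) =
    assemble (block-injective (proj₂ digits≡)) (proj₁ digits≡)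
    where
    gap≡ : gap s j i b ≡ gap t j′ i′ b′
    gap≡ = Cong-<⇒≡ (gap<n {s} {j} i<K) (gap<n {t} {j′} i′<K)
      (Cong-+-cancel (≡⇒Cong {x = toℕ x} refl)
        (subst₂ (Cong n) (+-comm (toℕ x) _) (+-comm (toℕ x) _) (Cong-trans (Cong-sym span) span′)))

    digits≡ : residue s j (bit (not b) + i) ≡ residue t j′ (bit (not b′) + i′) × block i b ≡ block i′ b′
    digits≡ = digits-unique (residue<N s j _) (residue<N t j′ _) (suc-injective gap≡)

    assemble : i ≡ i′ × b ≡ b′ → residue s j (bit (not b) + i) ≡ residue t j′ (bit (not b′) + i′) →
      Match _ _ _ _ _ _ _ _
    assemble (refl , refl) residue≡ = matched i b i<K residue≡ at at′ span

  -- Going from `x` to `y` and back would make the sum of two gaps 0 modulo `n`, but this sum is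
  -- positive and below `n`.
  Joins-asym : ∀ {s j t j′ g g′ x y} → Joins s j g x y → Joins t j′ g′ y x → ⊥
  Joins-asym {s} {j} {t} {j′} {x = x} {y} (joined i b i<K _ span) (joined i′ b′ i′<K _ span′)
    = 1+n≢0 (Cong-<⇒≡ (gap+gap<n {s} {j} {i} {b} {t} {j′} {i′} {b′} i<K i′<K) z<s
      (Cong-+-cancel (≡⇒Cong {x = toℕ x} refl) (Cong-sym (Cong-trans span′
        (Cong-trans (Cong-+-cong span (≡⇒Cong refl)) (≡⇒Cong (rotate (toℕ x) _ _)))))))
    where
    rotate : ∀ a b c → a + b + c ≡ b + c + a
    rotate = solve-∀

  -- Each system is a cyclic cycle system

  -- The case `t = 0` of `exchange⇒≡`. It makes the low vertices of a base cycle distinct already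
  -- modulo `N`.
  Cong-scaled-index : ∀ {s i i′} → s ≢ 0 → s ≤ m → Cong N (s * (i % K)) (s * (i′ % K)) → i % K ≡ i′ % K
  Cong-scaled-index {s} {i} {i′} s≢0 s≤m p =
    exchange⇒≡ {N} {m} {K} {s} {0} mK<N s≤m z≤n (i%K≤K i) (i%K≤K i′) s≢0 (Cong-+-cong p (≡⇒Cong refl))

  low-injective : ∀ {s j i i′} → s ≢ 0 → s ≤ m → i < K → i′ < K → low s j i ≡ low s j i′ → i ≡ i′
  low-injective {s} {j} {i} {i′} s≢0 s≤m i<K i′<K eq =
    trans (sym (m<n⇒m%n≡m i<K)) (trans (Cong-scaled-index {s} {i} {i′} s≢0 s≤m
      (Cong-+-cancel (≡⇒Cong {x = j} refl) (subst₂ (Cong N) (+-comm j _) (+-comm j _)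
        (Cong-trans (Cong-sym (Cong-low s j i)) (Cong-trans (≡⇒Cong eq) (Cong-low s j i′))))))
      (m<n⇒m%n≡m i′<K))

  vertex-injective : ∀ {s j e e′} → s ≢ 0 → s ≤ m → e < K * 2 → e′ < K * 2 →
    vertex s j e ≡ vertex s j e′ → e ≡ e′
  vertex-injective {s} {j} {e} {e′} s≢0 s≤m e<2K e′<2K eq with halves e | halves e′
  ... | half i false | half i′ false =
        cong (_* 2) (low-injective {s} {j} s≢0 s≤m (half< false e<2K) (half< false e′<2K)
          (trans (sym (vertex-even s j i)) (trans eq (vertex-even s j i′))))
  ... | half i false | half i′ true  = contradiction
        (trans (sym (vertex-even s j i)) (trans eq (vertex-odd s j i′)))
        (<⇒≢ (low<high s j i i′))
  ... | half i true  | half i′ false = contradiction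
        (trans (sym (vertex-even s j i′)) (trans (sym eq) (vertex-odd s j i)))
        (<⇒≢ (low<high s j i′ i))
  ... | half i true  | half i′ true  = cong (λ i → suc (i * 2)) (high-injective s j
        (trans (sym (vertex-odd s j i)) (trans eq (vertex-odd s j i′))))

  vertex<n : ∀ s j {e} → e < K * 2 → vertex s j e < n
  vertex<n s j {e} e<2K with halves e
  ... | half i false = ≤-<-trans (≤-reflexive (vertex-even s j i))
                         (<-trans (low<high s j i i) (high<n s j (half< false e<2K)))
  ... | half i true  = ≤-<-trans (≤-reflexive (vertex-odd s j i))
                         (high<n s j (half< true e<2K))

  base-isCycle : ∀ {s} j g → s ≢ 0 → s ≤ m → IsCycle (base s j g)
  base-isCycle {s} j g s≢0 s≤m = ≤-trans (s≤s (s≤s (s≤s z≤n))) (*-monoʳ-≤ 4 2≤k) , injective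
    where
    injective : ∀ {a b} → base s j g a ≡ base s j g b → a ≡ b
    injective {a} {b} eq = toℕ-injective (vertex-injective {s} {j} s≢0 s≤m a<2K b<2K
      (Cong-<⇒≡ (vertex<n s j a<2K) (vertex<n s j b<2K) (Cong-+-cancelʳ (toℕ g)
        (Cong-trans (Cong-sym (Cong-walk s j g (toℕ a)))
          (Cong-trans (≡⇒Cong (cong toℕ eq)) (Cong-walk s j g (toℕ b)))))))
      where
      a<2K = ≤-trans (toℕ<n a) (≤-reflexive order≡)
      b<2K = ≤-trans (toℕ<n b) (≤-reflexive order≡)

  -- The match fixes `i` and `b`; equal residues then give `j` modulo `N`, and the position of the
  -- low end gives `g`.
  Joins-unique : ∀ {s x y g g′} {j j′ : Fin N} →
    Joins s (toℕ j) g x y → Joins s (toℕ j′) g′ x y → j ≡ j′ × g ≡ g′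
  Joins-unique {s} {x} {y} {g} {g′} {j} {j′} J J′ = unique (match J J′)
    where
    unique : Match s (toℕ j) s (toℕ j′) g g′ x y → j ≡ j′ × g ≡ g′
    unique (matched i b i<K residue≡ at at′ _) = j≡j′ , g≡g′
      where
      p = bit (not b) + i
      j≡j′ : j ≡ j′
      j≡j′ = Cong⇒≡ (Cong-+-cancelʳ (s * (p % K))
        (Cong-trans (Cong-sym (Cong-residue s (toℕ j) p))
          (Cong-trans (≡⇒Cong residue≡) (Cong-residue s (toℕ j′) p))))
      g≡g′ : g ≡ g′
      g≡g′ = Cong⇒≡ (Cong-+-cancel (≡⇒Cong (cong (λ j → low s (toℕ j) (bit b + i)) j≡j′))
        (subst₂ (Cong n) (+-comm _ (toℕ g)) (+-comm _ (toℕ g′)) (Cong-trans (Cong-sym at) at′)))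

  -- Divide `d` by `N`: the quotient selects `i` and `b` through the blocks, the remainder is a
  -- residue that is solved for `j`, and `g` moves the low end to `x`.
  Joins-exist : ∀ s {d} {x y : Fin n} → d < K * 2 * N → Cong n (toℕ y) (toℕ x + suc d) →
    ∃ λ (j : Fin N) → ∃ λ g → Joins s (toℕ j) g x y
  Joins-exist s {d} {x} {y} d<2KN x→y = construct (block-surjective (d / N) (m<n*o⇒m/o<n d<2KN))
    where
    solve-shift : ∀ M .{{_ : NonZero M}} (a b : ℕ) → ∃ λ (z : Fin M) → Cong M (b + toℕ z) a
    -- Modulo `M` the summand `b * M-1` is `−b`, so the witness is `a − b`.
    solve-shift M@(suc M-1) a b = (a + b * M-1) mod M ,
      Cong-trans (Cong-+-cong (≡⇒Cong {x = b} refl) (Cong-mod (a + b * M-1)))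
        (Cong-trans (≡⇒Cong (collect a b M-1)) (Cong-drop a b))
      where
      collect : ∀ a b c → b + (a + b * c) ≡ a + b * suc c
      collect = solve-∀

    construct : (∃ λ i → i < K × ∃ λ b → block i b ≡ d / N) →
      ∃ λ (j : Fin N) → ∃ λ g → Joins s (toℕ j) g x y
    construct (i , i<K , b , block≡) = j , g , joined i b i<K at span
      where
      p    = bit (not b) + i
      j∃   = solve-shift N (d % N) (s * (p % K))
      j    = proj₁ j∃
      ℓ    = low s (toℕ j) (bit b + i)
      g∃   = solve-shift n (toℕ x) ℓ
      g    = proj₁ g∃

      residue≡ : residue s (toℕ j) p ≡ d % N
      residue≡ = Cong-<⇒≡ (residue<N s (toℕ j) p) (m%n<n d N)
        (Cong-trans (Cong-residue s (toℕ j) p)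
          (Cong-trans (≡⇒Cong (+-comm (toℕ j) _)) (proj₂ j∃)))

      gap≡ : gap s (toℕ j) i b ≡ suc d
      gap≡ = cong suc (trans (cong₂ (λ r q → r + q * N) residue≡ block≡) (sym (m≡m%n+[m/n]*n d N)))

      at : Cong n (toℕ x) (ℓ + toℕ g)
      at = Cong-sym (proj₂ g∃)

      span : Cong n (toℕ y) (toℕ x + gap s (toℕ j) i b)
      span = subst (λ D → Cong n (toℕ y) (toℕ x + D)) (sym gap≡) x→y

  Distance : Fin n → Fin n → Set
  Distance x y = ∃ λ d → d < K * 2 * N × Cong n (toℕ y) (toℕ x + suc d)

  -- If `y − x` exceeds `K * 2 * N`, half of `n − 1`, then the difference in the other direction,
  -- `n − (y − x)`, does not.
  <⇒distance : ∀ {x y : Fin n} → toℕ x < toℕ y → Distance x y ⊎ Distance y x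
  <⇒distance {x} {y} x<y with m≤n⇒∃[o]m+o≡n x<y
  ... | d , 1+x+d≡y with d <? K * 2 * N
  ...   | yes d<H = inj₁ (d , d<H , ≡⇒Cong (trans (sym 1+x+d≡y) (sym (+-suc (toℕ x) d))))
  ...   | no  d≮H = inj₂ (complement (m≤n⇒∃[o]m+o≡n 1+d≤2H))
    where
    H = K * 2 * N

    1+d≤2H : suc d ≤ H + H
    1+d≤2H = begin
      suc d                    ≤⟨ m≤n+m (suc d) (toℕ x) ⟩
      toℕ x + suc d            ≡⟨ +-suc (toℕ x) d ⟩
      suc (toℕ x) + d          ≡⟨ 1+x+d≡y ⟩
      toℕ y                    ≤⟨ ≤-pred (toℕ<n y) ⟩
      8 * N * k                ≡⟨ half-order ⟨
      H + H                    ∎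
      where open ≤-Reasoning

    complement : (∃ λ d′ → suc d + d′ ≡ H + H) → Distance y x
    complement (d′ , 1+d+d′≡2H) = d′ , d′<H , Cong-sym (Cong-trans (≡⇒Cong wraps) (Cong-drop (toℕ x) 1))
      where
      d′<H : d′ < H
      d′<H = +-cancelˡ-≤ H (suc d′) H (begin
        H + suc d′     ≤⟨ +-monoˡ-≤ (suc d′) (≮⇒≥ d≮H) ⟩
        d + suc d′     ≡⟨ +-suc d d′ ⟩
        suc d + d′     ≡⟨ 1+d+d′≡2H ⟩
        H + H          ∎)
        where open ≤-Reasoning

      regroup : ∀ x d d′ → suc x + d + suc d′ ≡ x + suc (suc d + d′)
      regroup = solve-∀

      wraps : toℕ y + suc d′ ≡ toℕ x + 1 * n
      wraps = trans (cong (_+ suc d′) (sym 1+x+d≡y)) (trans (regroup (toℕ x) d d′)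
        (cong (toℕ x +_) (trans (cong suc (trans 1+d+d′≡2H half-order)) (sym (*-identityˡ n)))))

  ≢⇒distance : ∀ {x y : Fin n} → x ≢ y → Distance x y ⊎ Distance y x
  ≢⇒distance {x} {y} x≢y with <-cmp (toℕ x) (toℕ y)
  ... | tri< x<y _ _ = <⇒distance x<y
  ... | tri≈ _ x≡y _ = contradiction (toℕ-injective x≡y) x≢y
  ... | tri> _ _ y<x with <⇒distance y<x
  ...   | inj₁ p = inj₂ p
  ...   | inj₂ p = inj₁ p

  parameters : Fin (N * n) → Fin N × Fin n
  parameters = remQuot n

  -- There are `N` base cycles with `n` translates each; `N * n` cycles of length `4k` have
  -- `n (n − 1) / 2` edges in total, as many as the complete graph.
  system : ℕ → CycleFamily (4 * k) n
  system s = record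
    { size = N * n
    ; cyc  = λ t → base s (toℕ (proj₁ (parameters t))) (proj₂ (parameters t))
    }

  parameters-combine : ∀ (j : Fin N) (g : Fin n) → parameters (combine j g) ≡ (j , g)
  parameters-combine = remQuot-combine

  system-isCycleSystem : ∀ {s} → s ≢ 0 → s ≤ m → IsCycleSystem (system s)
  system-isCycleSystem {s} s≢0 s≤m =
    (λ t → base-isCycle (toℕ (proj₁ (parameters t))) (proj₂ (parameters t)) s≢0 s≤m) , decompose
    where
    Covered : Fin n → Fin n → Set
    Covered x y = ∃ λ t → HasEdge (cyc (system s) t) x y ×
      (∀ t′ → HasEdge (cyc (system s) t′) x y → t′ ≡ t)

    covered : ∀ {x y} {j : Fin N} {g} → Joins s (toℕ j) g x y → Covered x y
    covered {x} {y} {j} {g} J = combine j g ,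
        subst (λ q → HasEdge (base s (toℕ (proj₁ q)) (proj₂ q)) x y)
          (sym (parameters-combine j g)) (Joins⇒HasEdge J) ,
        unique
      where
      unique : ∀ t′ → HasEdge (cyc (system s) t′) x y → t′ ≡ combine j g
      unique t′ edge with HasEdge⇒Joins edge
      ... | inj₁ J′ = trans (sym (combine-remQuot {N} n t′))
                        (cong₂ combine (proj₁ (Joins-unique J′ J)) (proj₂ (Joins-unique J′ J)))
      ... | inj₂ J′ = ⊥-elim (Joins-asym J J′)

    Covered-sym : ∀ {x y} → Covered x y → Covered y x
    Covered-sym (t , edge , unique) = t , HasEdge-sym edge , λ t′ edge′ → unique t′ (HasEdge-sym edge′)

    decompose : ∀ x y → x ≢ y → Covered x y
    decompose x y x≢y with ≢⇒distance x≢y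
    ... | inj₁ (d , d<H , p) = covered (proj₂ (proj₂ (Joins-exist s d<H p)))
    ... | inj₂ (d , d<H , p) = Covered-sym (covered (proj₂ (proj₂ (Joins-exist s d<H p))))

  -- Translating by `h` keeps `j` and replaces `g` by `shift h g`; the two cycles agree vertex by
  -- vertex.
  system-isCyclic : ∀ s → IsCyclic (system s)
  system-isCyclic s t h = combine j (shift h g) ,
      subst (λ q → SameEdges (translate h (cyc (system s) t)) (base s (toℕ (proj₁ q)) (proj₂ q)))
        (sym (parameters-combine j (shift h g)))
        (≗⇒SameEdges (λ i → shift-shift h g (vertex s (toℕ j) (toℕ i) mod n)))
    where
    j = proj₁ (parameters t)
    g = proj₂ (parameters t)

  -- Orthogonality

  -- The offsets `j` and `j′` occur on both sides and cancel, leaving the hypothesis of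
  -- `exchange⇒≡`.
  exchanged-index : ∀ {s t j j′ i i′} → s ≤ m → t ≤ m → s ≢ t →
    Cong N ((j + s * (i % K)) + (j′ + t * (i′ % K))) ((j′ + t * (i % K)) + (j + s * (i′ % K))) →
    Cong K i i′
  exchanged-index {s} {t} {j} {j′} {i} {i′} s≤m t≤m s≢t p =
    Cong-trans (Cong-sym (Cong-% i)) (Cong-trans (≡⇒Cong X≡Y) (Cong-% i′))
    where
    X = i % K
    Y = i′ % K

    collect : ∀ a b c d → a + b + (c + d) ≡ b + d + (a + c)
    collect = solve-∀

    collect′ : ∀ a b c d → c + d + (a + b) ≡ b + d + (a + c)
    collect′ = solve-∀

    X≡Y : X ≡ Y
    X≡Y = exchange⇒≡ {N} {m} {K} {s} {t} mK<N s≤m t≤m (i%K≤K i) (i%K≤K i′) s≢t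
      (Cong-+-cancelʳ (j + j′)
        (subst₂ (Cong N) (collect j (s * X) j′ (t * Y)) (collect′ j (s * Y) j′ (t * X)) p))

  2<K : 2 < K
  2<K = ≤-trans (s≤s (s≤s (s≤s z≤n))) (*-monoˡ-≤ 2 2≤k)

  -- Together the two congruences give `2 ≡ 0` modulo `K`, while `K > 2`.
  shifts-incompatible : ∀ {i i′} → Cong K (suc i) i′ → ¬ Cong K i (suc i′)
  shifts-incompatible {i} {i′} p q = 0≢1+n (Cong-<⇒≡ (≤-trans (s≤s z≤n) 2<K) 2<K
    (Cong-+-cancelʳ i (Cong-trans q (Cong-+-cong (≡⇒Cong {x = 1} refl) (Cong-sym p)))))

  -- The two indices are those of the low neighbours of `hᵢ`, in an order given by `b`. For equal
  -- `b` one of the congruences is `i ≡ i′` itself; different `b` would identify the neighbouring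
  -- pairs in reverse order.
  ends⇒edge≡ : ∀ {i i′ b b′} → i < K → i′ < K → Cong K (bit b + i) (bit b′ + i′) →
    Cong K (bit (not b) + i) (bit (not b′) + i′) → i ≡ i′ × b ≡ b′
  ends⇒edge≡ {b = false} {false} i<K i′<K p _ = Cong-<⇒≡ i<K i′<K p , refl
  ends⇒edge≡ {b = true}  {true}  i<K i′<K _ q = Cong-<⇒≡ i<K i′<K q , refl
  ends⇒edge≡ {b = false} {true}  _ _ p q = contradiction p (shifts-incompatible q)
  ends⇒edge≡ {b = true}  {false} _ _ p q = contradiction q (shifts-incompatible p)

  shared-edge-unique : ∀ {s t j j′ g g′ x y u v} → s ≤ m → t ≤ m → s ≢ t →
    Match s j t j′ g g′ x y → Match s j t j′ g g′ u v → x ≡ u × y ≡ v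
  shared-edge-unique {s} {t} {j} {j′} {g} {g′} {x} {y} {u} {v} s≤m t≤m s≢t
    (matched i b i<K residue₁ at₁ at₁′ span₁) (matched i₂ b₂ i₂<K residue₂ at₂ at₂′ span₂) =
      conclude (ends⇒edge≡ i<K i₂<K low-index gap-index)
    where
    p = bit (not b) + i
    q = bit (not b₂) + i₂
    λ₁ = bit b + i
    λ₂ = bit b₂ + i₂

    -- Each shared edge equates the residues of the two systems at one index, `p` or `q`. Adding the
    -- first equation to the reverse of the second gives the exchange pattern.
    gap-index : Cong K p q
    gap-index = exchanged-index {s} {t} {j} {j′} {p} {q} s≤m t≤m s≢t
      (Cong-trans (Cong-sym (Cong-+-cong (Cong-residue s j p) (Cong-residue t j′ q)))
        (Cong-trans (≡⇒Cong (cong₂ _+_ residue₁ (sym residue₂)))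
          (Cong-+-cong (Cong-residue t j′ p) (Cong-residue s j q))))

    collect : ∀ a b c d → a + c + (b + d) ≡ a + b + (c + d)
    collect = solve-∀

    collect′ : ∀ a b c d → b + d + (a + c) ≡ b + a + (c + d)
    collect′ = solve-∀

    -- Each shared low end relates `g` and `g′`. Adding the first relation to the reverse of the
    -- second cancels both translations, and the resulting equality can be read modulo `N`.
    low-sum : low s j λ₁ + low t j′ λ₂ ≡ low t j′ λ₁ + low s j λ₂
    low-sum = Cong-<⇒≡ (low+low<n s j λ₁ t j′ λ₂) (low+low<n t j′ λ₁ s j λ₂)
      (Cong-+-cancelʳ (toℕ g + toℕ g′)
        (subst₂ (Cong n) (collect (low s j λ₁) (low t j′ λ₂) (toℕ g) (toℕ g′))
                         (collect′ (low s j λ₂) (low t j′ λ₁) (toℕ g) (toℕ g′))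
          (Cong-+-cong (Cong-trans (Cong-sym at₁) at₁′) (Cong-trans (Cong-sym at₂′) at₂))))

    low-index : Cong K λ₁ λ₂
    low-index = exchanged-index {s} {t} {j} {j′} {λ₁} {λ₂} s≤m t≤m s≢t
      (Cong-trans (Cong-sym (Cong-+-cong (Cong-low s j λ₁) (Cong-low t j′ λ₂)))
        (Cong-trans (≡⇒Cong low-sum) (Cong-+-cong (Cong-low t j′ λ₁) (Cong-low s j λ₂))))

    conclude : i ≡ i₂ × b ≡ b₂ → x ≡ u × y ≡ v
    conclude (refl , refl) = x≡u ,
        Cong⇒≡ (Cong-trans span₁ (Cong-trans
          (Cong-+-cong (≡⇒Cong (cong toℕ x≡u)) (≡⇒Cong refl)) (Cong-sym span₂)))
      where
      x≡u = Cong⇒≡ (Cong-trans at₁ (Cong-sym at₂))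

  bases-orthogonal : ∀ {s t} j j′ g g′ → s ≤ m → t ≤ m → s ≢ t →
    AtMostOneCommonEdge (base s j g) (base t j′ g′)
  bases-orthogonal {s} {t} j j′ g g′ s≤m t≤m s≢t x y u v c∋xy d∋xy c∋uv d∋uv
    with common c∋xy d∋xy | common c∋uv d∋uv
    where
    common : ∀ {x y} → HasEdge (base s j g) x y → HasEdge (base t j′ g′) x y →
      Match s j t j′ g g′ x y ⊎ Match s j t j′ g g′ y x
    common c∋xy d∋xy with HasEdge⇒Joins c∋xy | HasEdge⇒Joins d∋xy
    ... | inj₁ J | inj₁ J′ = inj₁ (match J J′)
    ... | inj₁ J | inj₂ J′ = ⊥-elim (Joins-asym J J′)
    ... | inj₂ J | inj₁ J′ = ⊥-elim (Joins-asym J J′)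
    ... | inj₂ J | inj₂ J′ = inj₂ (match J J′)
  ... | inj₁ M | inj₁ M′ = inj₁ (shared-edge-unique s≤m t≤m s≢t M M′)
  ... | inj₁ M | inj₂ M′ = inj₂ (shared-edge-unique s≤m t≤m s≢t M M′)
  ... | inj₂ M | inj₁ M′ = inj₂ (swap (shared-edge-unique s≤m t≤m s≢t M M′))
  ... | inj₂ M | inj₂ M′ = inj₁ (swap (shared-edge-unique s≤m t≤m s≢t M M′))

  systems-orthogonal : ∀ {s t} → s ≤ m → t ≤ m → s ≢ t → Orthogonal (system s) (system t)
  systems-orthogonal s≤m t≤m s≢t a b =
    bases-orthogonal (toℕ (proj₁ (parameters a))) (toℕ (proj₁ (parameters b)))
      (proj₂ (parameters a)) (proj₂ (parameters b)) s≤m t≤m s≢t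

  systems : MOCyclicSystems m (4 * k) n
  -- The slopes `s` are 1, ..., `m`; for `s = 0` all residues would agree and `l₀ = l₂`.
  systems = (λ i → system (suc (toℕ i))) ,
    (λ i → system-isCycleSystem 1+n≢0 (toℕ<n i) , system-isCyclic (suc (toℕ i))) ,
    (λ i j i≢j → systems-orthogonal (toℕ<n i) (toℕ<n j)
      (λ eq → i≢j (toℕ-injective (suc-injective eq))))

-- The number of systems

theorem13 : (k N : ℕ) → 2 ≤ k → 1 ≤ N →
    ∃ λ m → (N ≤ suc m * (16 * k ∸ 2)) × MOCyclicSystems m (4 * k) (suc (8 * N * k))
theorem13 k N 2≤k 1≤N = m , N≤[1+m]D , Construction.systems k N m 2≤k mK<N
  where
  open ≤-Reasoning
  D = 16 * k ∸ 2

  2k≤D : k * 2 ≤ D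
  2k≤D = m+n≤o⇒m≤o∸n (k * 2) (begin
    k * 2 + 2      ≤⟨ +-monoʳ-≤ (k * 2) (≤-trans 2≤k (m≤m*n k 2)) ⟩
    k * 2 + k * 2  ≡⟨ *-distribˡ-+ k 2 2 ⟨
    k * 4          ≡⟨ *-comm k 4 ⟩
    4 * k          ≤⟨ *-monoˡ-≤ k {4} {16} (m≤m+n 4 12) ⟩
    16 * k         ∎)

  instance
    N-nonZero : NonZero N
    N-nonZero = >-nonZero 1≤N
    D-nonZero : NonZero D
    D-nonZero = >-nonZero (≤-trans (≤-trans (s≤s z≤n) (*-monoˡ-≤ 2 2≤k)) 2k≤D)

  -- The largest `m` with `m * D < N`. Maximality yields `m ≥ N / D − 1`, cleared of its
  -- denominator, and `2k ≤ D` yields `m * 2k < N`.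
  m = (N ∸ 1) / D

  N≡ : suc (N ∸ 1) ≡ N
  N≡ = m+[n∸m]≡n 1≤N

  mK<N : m * (k * 2) < N
  mK<N = begin-strict
    m * (k * 2) ≤⟨ *-monoʳ-≤ m 2k≤D ⟩
    m * D       ≤⟨ m/n*n≤m (N ∸ 1) D ⟩
    N ∸ 1       <⟨ ≤-reflexive N≡ ⟩
    N           ∎

  N≤[1+m]D : N ≤ suc m * D
  N≤[1+m]D = begin
    N                               ≡⟨ N≡ ⟨
    suc (N ∸ 1)                     ≡⟨ cong suc (m≡m%n+[m/n]*n (N ∸ 1) D) ⟩
    suc ((N ∸ 1) % D) + m * D       ≤⟨ +-monoˡ-≤ (m * D) (m%n<n (N ∸ 1) D) ⟩
    suc m * D                       ∎
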